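{- Let $G$ be a finite simple graph and let $(G,\pm)$ be the signed graph obtained from $G$ by replacing every edge by a positive--negative digon. Then $$\mathrm{BSTAB}(G,\pm)=\mathrm{STAB}(G),\qquad \mathrm{BTH}(G,\pm)=\mathrm{TH}(G),\qquad \mathrm{BQSTAB}(G,\pm)=\mathrm{QSTAB}(G).$$
   Context: Signed graphs. A signed graph is a pair $\Sigma=(G,\sigma)$ with $G$ a finite graph and $\sigma:E(G)\to\{+1,-1\}$. Positive loops are allowed, negative loops are excluded; between two distinct vertices there may be both a positive and a negative edge (a digon); repeated edges of the same sign are immaterial. Convention: every signed graph is replaced by its completion having a positive loop at every vertex. A signed graph is balanced if every cycle has positive sign (product of edge signs; a digon is a negative cycle); a set $B\subseteq V(\Sigma)$ is balanced if the induced signed graph $\Sigma[B]$ is balanced. Conflict graph. $C(\Sigma)$ is the ordinary simple graph on $V(\Sigma)\times\{\pm1\}$ with $(u,s)\sim(v,r)$ iff there is an edge $e=uv$ of $\Sigma$ (possibly a loop, $u=v$) with $r=-\sigma(e)s$. In particular $(v,+)\sim(v,-)$ for all $v$. Ordinary bodies. For a finite simple graph $H$: $\mathrm{STAB}(H)=\operatorname{conv}\{\mathbf 1_I: I\text{ stable in }H\}$; $\mathrm{QSTAB}(H)=\{x\ge0: x(K)\le1\text{ for every clique }K\}$, with $x(K)=\sum_{v\in K}x_v$; $\mathrm{TH}(H)=\{x:\exists\, X\text{ symmetric with }\begin{pmatrix} 1 & x^{\mathsf T} \\ x & X \end{pmatrix}\succeq0,\ \operatorname{diag}X=x,\ X_{uv}=0\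 (uv\in E(H))\}$. Signed bodies. Let $p:\mathbb R^{V(\Sigma)\times\{\pm1\}}\to\mathbb R^{V(\Sigma)}$, $p(y)_v=y_{(v,+)}+y_{(v,-)}$. Then $\mathrm{BSTAB}(\Sigma)=\operatorname{conv}\{\mathbf 1_B:B\subseteq V(\Sigma)\text{ balanced}\}$, $\mathrm{BTH}(\Sigma)=p(\mathrm{TH}(C(\Sigma)))$, and $\mathrm{BQSTAB}(\Sigma)=p(\mathrm{QSTAB}(C(\Sigma)))$. -}

module Defs where

open import Algebra.Bundles.Raw using (RawMonoid)
import Algebra.Definitions.RawMonoid as RawMonoidDefs
open import Data.Bool.Base using (Bool; if_then_else_; T)
open import Data.Fin.Base using (Fin; zero; suc; toℕ)
open import Data.Fin.Properties using (1↔⊤; +↔⊎; *↔×)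
open import Data.Nat.Base as ℕ using (ℕ; _⊔_)
open import Data.Nat.DivMod using (_mod_)
import Data.Nat.Properties as ℕ
open import Data.Product.Base using (Σ; ∃; _×_; _,_; proj₁)
open import Data.Product.Function.NonDependent.Propositional using (_×-↔_)
open import Data.Rational.Base as ℚ using (ℚ; 0ℚ; 1ℚ; ½; ∣_∣)
import Data.Rational.Properties as ℚ
open import Data.Rational.Solver using (module +-*-Solver)
open import Data.Sign.Base as Sign using (Sign; opposite)
open import Data.Sum.Base using (_⊎_; inj₁; inj₂)
open import Data.Sum.Function.Propositional using (_⊎-↔_)
open import Data.Unit.Base using (⊤)
open import Function.Base using (_∘_; _on_)
open import Function.Bundles using (_↔_; mk↔ₛ′; Inverse)
open import Function.Definitions using (Injective)
open import Function.Properties.Inverse using (↔-trans)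
open import Level using (0ℓ)
open import Relation.Binary.Core using (Rel)
open import Relation.Binary.Definitions using (Symmetric; Irreflexive)
open import Relation.Binary.PropositionalEquality
  using (_≡_; _≢_; refl; sym; cong; subst; module ≡-Reasoning)
open import Relation.Nullary.Negation using (¬_)
open import Relation.Unary using (Pred; _∈_)

-- Real numbers are Cauchy sequences of rationals, with a setoid equality.

IsCauchy : (ℕ → ℚ) → Set
IsCauchy x = ∀ {ε} → 0ℚ ℚ.< ε →
  ∃ λ N → ∀ {m n} → N ℕ.≤ m → N ℕ.≤ n → ∣ x m ℚ.- x n ∣ ℚ.< ε

record ℝ : Set where
  constructor mkℝ
  field
    seq    : ℕ → ℚ
    cauchy : IsCauchy seq

open ℝ public

infix 4 _≈_ _≤_

_≈_ : Rel ℝ 0ℓ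
x ≈ y = ∀ {ε} → 0ℚ ℚ.< ε →
  ∃ λ N → ∀ {n} → N ℕ.≤ n → ∣ seq x n ℚ.- seq y n ∣ ℚ.< ε

-- The non-strict order: x exceeds y by at most any prescribed ε > 0,
-- eventually.  (Termwise comparison would not be invariant under _≈_.)
_≤_ : Rel ℝ 0ℓ
x ≤ y = ∀ {ε} → 0ℚ ℚ.< ε →
  ∃ λ N → ∀ {n} → N ℕ.≤ n → seq x n ℚ.< seq y n ℚ.+ ε

fromℚ : ℚ → ℝ
fromℚ q = mkℝ (λ _ → q) λ {ε} ε>0 →
  0 , λ _ _ → subst (λ d → ∣ d ∣ ℚ.< ε) (sym (ℚ.+-inverseʳ q)) ε>0

0ℝ 1ℝ : ℝ
0ℝ = fromℚ 0ℚ
1ℝ = fromℚ 1ℚ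

private
  module _ where
    open +-*-Solver

    diff-+ : ∀ p q → p ≡ (p ℚ.- q) ℚ.+ q
    diff-+ = solve 2 (λ p q → p := (p :- q) :+ q) refl

    diff-of-+ : ∀ p q r s → (p ℚ.+ q) ℚ.- (r ℚ.+ s) ≡ (p ℚ.- r) ℚ.+ (q ℚ.- s)
    diff-of-+ = solve 4 (λ p q r s → (p :+ q) :- (r :+ s) := (p :- r) :+ (q :- s)) refl

    diff-of-* : ∀ p q r s → p ℚ.* q ℚ.- r ℚ.* s ≡ p ℚ.* (q ℚ.- s) ℚ.+ s ℚ.* (p ℚ.- r)
    diff-of-* = solve 4 (λ p q r s → p :* q :- r :* s := p :* (q :- s) :+ s :* (p :- r)) refl

    swap : ∀ p q r → p ℚ.* (q ℚ.* r) ≡ q ℚ.* (p ℚ.* r)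
    swap = solve 3 (λ p q r → p :* (q :* r) := q :* (p :* r)) refl

  pos-* : ∀ {p q} → 0ℚ ℚ.< p → 0ℚ ℚ.< q → 0ℚ ℚ.< p ℚ.* q
  pos-* {p} {q} p>0 q>0 = ℚ.positive⁻¹ (p ℚ.* q) {{ℚ.pos*pos⇒pos p {{ℚ.positive p>0}} q {{ℚ.positive q>0}}}}

  pos-+ : ∀ {p q} → 0ℚ ℚ.< p → 0ℚ ℚ.< q → 0ℚ ℚ.< p ℚ.+ q
  pos-+ {p} {q} p>0 q>0 = ℚ.positive⁻¹ (p ℚ.+ q) {{ℚ.pos+pos⇒pos p {{ℚ.positive p>0}} q {{ℚ.positive q>0}}}}

  pos-½ : ∀ {p} → 0ℚ ℚ.< p → 0ℚ ℚ.< p ℚ.* ½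
  pos-½ p>0 = pos-* p>0 (ℚ.positive⁻¹ ½)

  halves : ∀ p → p ℚ.* ½ ℚ.+ p ℚ.* ½ ≡ p
  halves p = begin
    p ℚ.* ½ ℚ.+ p ℚ.* ½  ≡⟨ ℚ.*-distribˡ-+ p ½ ½ ⟨
    p ℚ.* (½ ℚ.+ ½)      ≡⟨ ℚ.*-identityʳ p ⟩
    p                    ∎
    where open ≡-Reasoning

  bounded : (x : ℝ) → ∃ λ B → 0ℚ ℚ.< B ×
            ∃ λ N → ∀ {n} → N ℕ.≤ n → ∣ seq x n ∣ ℚ.< B
  bounded x with cauchy x (ℚ.positive⁻¹ 1ℚ)
  ... | N , close = B , B>0 , N , bound
    where
    a = seq x
    B = 1ℚ ℚ.+ ∣ a N ∣
    B>0 : 0ℚ ℚ.< B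
    B>0 = ℚ.+-mono-<-≤ (ℚ.positive⁻¹ 1ℚ) (ℚ.0≤∣p∣ (a N))
    open ℚ.≤-Reasoning
    bound : ∀ {n} → N ℕ.≤ n → ∣ a n ∣ ℚ.< B
    bound {n} N≤n = begin-strict
      ∣ a n ∣                       ≡⟨ cong ∣_∣ (diff-+ (a n) (a N)) ⟩
      ∣ (a n ℚ.- a N) ℚ.+ a N ∣     ≤⟨ ℚ.∣p+q∣≤∣p∣+∣q∣ (a n ℚ.- a N) (a N) ⟩
      ∣ a n ℚ.- a N ∣ ℚ.+ ∣ a N ∣   <⟨ ℚ.+-monoˡ-< ∣ a N ∣ (close N≤n ℕ.≤-refl) ⟩
      B                             ∎

  ∣*∣-mono : ∀ {p q r s} → ∣ p ∣ ℚ.< r → ∣ q ∣ ℚ.< s → ∣ p ℚ.* q ∣ ℚ.≤ r ℚ.* s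
  ∣*∣-mono {p} {q} {r} {s} p<r q<s = begin
    ∣ p ℚ.* q ∣      ≡⟨ ℚ.∣p*q∣≡∣p∣*∣q∣ p q ⟩
    ∣ p ∣ ℚ.* ∣ q ∣  ≤⟨ ℚ.*-monoʳ-≤-nonNeg ∣ q ∣ {{ℚ.∣-∣-nonNeg q}} (ℚ.<⇒≤ p<r) ⟩
    r ℚ.* ∣ q ∣      ≤⟨ ℚ.*-monoˡ-≤-nonNeg r {{ℚ.nonNegative (ℚ.≤-trans (ℚ.0≤∣p∣ p) (ℚ.<⇒≤ p<r))}} (ℚ.<⇒≤ q<s) ⟩
    r ℚ.* s          ∎
    where open ℚ.≤-Reasoning

  half< : ∀ {p} → 0ℚ ℚ.< p → p ℚ.* ½ ℚ.< p
  half< {p} p>0 = begin-strict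
    p ℚ.* ½                ≡⟨ ℚ.+-identityʳ (p ℚ.* ½) ⟨
    p ℚ.* ½ ℚ.+ 0ℚ         <⟨ ℚ.+-monoʳ-< (p ℚ.* ½) (pos-½ p>0) ⟩
    p ℚ.* ½ ℚ.+ p ℚ.* ½    ≡⟨ halves p ⟩
    p                      ∎
    where open ℚ.≤-Reasoning

  divide : ∀ {p q} → 0ℚ ℚ.< p → 0ℚ ℚ.< q → ∃ λ d → 0ℚ ℚ.< d × q ℚ.* d ≡ p
  divide {p} {q} p>0 q>0 =
    p ℚ.* ℚ.1/ q , pos-* p>0 (ℚ.positive⁻¹ (ℚ.1/ q) {{ℚ.1/pos⇒pos q}}) , (begin
      q ℚ.* (p ℚ.* ℚ.1/ q)    ≡⟨ swap q p (ℚ.1/ q) ⟩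
      p ℚ.* (q ℚ.* ℚ.1/ q)    ≡⟨ cong (p ℚ.*_) (ℚ.*-inverseʳ q) ⟩
      p ℚ.* 1ℚ                ≡⟨ ℚ.*-identityʳ p ⟩
      p                       ∎)
    where
    open ≡-Reasoning
    instance
      q-pos : ℚ.Positive q
      q-pos = ℚ.positive q>0
      q-nz : ℚ.NonZero q
      q-nz = ℚ.pos⇒nonZero q

  *-diff : ∀ {a b c d A B δ ε} → 0ℚ ℚ.< ε → (A ℚ.+ B) ℚ.* δ ≡ ε ℚ.* ½ →
           ∣ a ∣ ℚ.< A → ∣ d ∣ ℚ.< B → ∣ a ℚ.- c ∣ ℚ.< δ → ∣ b ℚ.- d ∣ ℚ.< δ →
           ∣ a ℚ.* b ℚ.- c ℚ.* d ∣ ℚ.< ε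
  *-diff {a} {b} {c} {d} {A} {B} {δ} {ε} ε>0 eq a<A d<B a-c<δ b-d<δ = begin-strict
    ∣ a ℚ.* b ℚ.- c ℚ.* d ∣
      ≡⟨ cong ∣_∣ (diff-of-* a b c d) ⟩
    ∣ a ℚ.* (b ℚ.- d) ℚ.+ d ℚ.* (a ℚ.- c) ∣
      ≤⟨ ℚ.∣p+q∣≤∣p∣+∣q∣ (a ℚ.* (b ℚ.- d)) (d ℚ.* (a ℚ.- c)) ⟩
    ∣ a ℚ.* (b ℚ.- d) ∣ ℚ.+ ∣ d ℚ.* (a ℚ.- c) ∣
      ≤⟨ ℚ.+-mono-≤ (∣*∣-mono {a} {b ℚ.- d} a<A b-d<δ) (∣*∣-mono {d} {a ℚ.- c} d<B a-c<δ) ⟩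
    A ℚ.* δ ℚ.+ B ℚ.* δ
      ≡⟨ ℚ.*-distribʳ-+ δ A B ⟨
    (A ℚ.+ B) ℚ.* δ
      ≡⟨ eq ⟩
    ε ℚ.* ½
      <⟨ half< ε>0 ⟩
    ε ∎
    where open ℚ.≤-Reasoning

  abstract
    +-cauchy : (x y : ℝ) → IsCauchy (λ n → seq x n ℚ.+ seq y n)
    +-cauchy x y {ε} ε>0 with cauchy x (pos-½ ε>0) | cauchy y (pos-½ ε>0)
    ... | M , closeˣ | N , closeʸ = M ⊔ N , close
      where
      a b : ℕ → ℚ
      a = seq x
      b = seq y
      close : ∀ {m n} → M ⊔ N ℕ.≤ m → M ⊔ N ℕ.≤ n →
              ∣ (a m ℚ.+ b m) ℚ.- (a n ℚ.+ b n) ∣ ℚ.< ε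
      close {m} {n} ≤m ≤n = begin-strict
        ∣ (a m ℚ.+ b m) ℚ.- (a n ℚ.+ b n) ∣
          ≡⟨ cong ∣_∣ (diff-of-+ (a m) (b m) (a n) (b n)) ⟩
        ∣ (a m ℚ.- a n) ℚ.+ (b m ℚ.- b n) ∣
          ≤⟨ ℚ.∣p+q∣≤∣p∣+∣q∣ (a m ℚ.- a n) (b m ℚ.- b n) ⟩
        ∣ a m ℚ.- a n ∣ ℚ.+ ∣ b m ℚ.- b n ∣
          <⟨ ℚ.+-mono-< (closeˣ (ℕ.m⊔n≤o⇒m≤o M N ≤m) (ℕ.m⊔n≤o⇒m≤o M N ≤n))
                        (closeʸ (ℕ.m⊔n≤o⇒n≤o M N ≤m) (ℕ.m⊔n≤o⇒n≤o M N ≤n)) ⟩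
        ε ℚ.* ½ ℚ.+ ε ℚ.* ½
          ≡⟨ halves ε ⟩
        ε ∎
        where
        open ℚ.≤-Reasoning

    *-cauchy : (x y : ℝ) → IsCauchy (λ n → seq x n ℚ.* seq y n)
    *-cauchy x y {ε} ε>0 =
      let A , A>0 , K , x<A = bounded x
          B , B>0 , L , y<B = bounded y
          δ , δ>0 , eq      = divide {ε ℚ.* ½} {A ℚ.+ B} (pos-½ ε>0) (pos-+ A>0 B>0)
          M , closeˣ        = cauchy x {δ} δ>0
          N , closeʸ        = cauchy y {δ} δ>0
      in combine A B δ K L M N eq x<A y<B closeˣ closeʸ
      where
      a b : ℕ → ℚ
      a = seq x
      b = seq y
      combine : ∀ A B δ K L M N → (A ℚ.+ B) ℚ.* δ ≡ ε ℚ.* ½ →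
        (∀ {n} → K ℕ.≤ n → ∣ a n ∣ ℚ.< A) →
        (∀ {n} → L ℕ.≤ n → ∣ b n ∣ ℚ.< B) →
        (∀ {m n} → M ℕ.≤ m → M ℕ.≤ n → ∣ a m ℚ.- a n ∣ ℚ.< δ) →
        (∀ {m n} → N ℕ.≤ m → N ℕ.≤ n → ∣ b m ℚ.- b n ∣ ℚ.< δ) →
        ∃ λ P → ∀ {m n} → P ℕ.≤ m → P ℕ.≤ n → ∣ a m ℚ.* b m ℚ.- a n ℚ.* b n ∣ ℚ.< ε
      combine A B δ K L M N eq x<A y<B closeˣ closeʸ =
        (K ⊔ M) ⊔ (L ⊔ N) , λ {m} {n} ≤m ≤n →
          let KM≤m = ℕ.m⊔n≤o⇒m≤o (K ⊔ M) (L ⊔ N) ≤m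
              KM≤n = ℕ.m⊔n≤o⇒m≤o (K ⊔ M) (L ⊔ N) ≤n
              LN≤m = ℕ.m⊔n≤o⇒n≤o (K ⊔ M) (L ⊔ N) ≤m
              LN≤n = ℕ.m⊔n≤o⇒n≤o (K ⊔ M) (L ⊔ N) ≤n
          in *-diff {a m} {b m} {a n} {b n} {A} {B} {δ} {ε} ε>0 eq
               (x<A (ℕ.m⊔n≤o⇒m≤o K M KM≤m))
               (y<B (ℕ.m⊔n≤o⇒m≤o L N LN≤n))
               (closeˣ (ℕ.m⊔n≤o⇒n≤o K M KM≤m) (ℕ.m⊔n≤o⇒n≤o K M KM≤n))
               (closeʸ (ℕ.m⊔n≤o⇒n≤o L N LN≤m) (ℕ.m⊔n≤o⇒n≤o L N LN≤n))

infixl 6 _+_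
infixl 7 _*_

_+_ _*_ : ℝ → ℝ → ℝ
x + y = mkℝ (λ n → seq x n ℚ.+ seq y n) (+-cauchy x y)
x * y = mkℝ (λ n → seq x n ℚ.* seq y n) (*-cauchy x y)

+-0-rawMonoid : RawMonoid 0ℓ 0ℓ
+-0-rawMonoid = record { _≈_ = _≈_ ; _∙_ = _+_ ; ε = 0ℝ }

open RawMonoidDefs +-0-rawMonoid public using (sum)

record Finite (A : Set) : Set where
  field
    size : ℕ
    enum : Fin size ↔ A

open Finite {{...}} public

-- The enumeration is only used to sum over A; the value of the sum does
-- not depend on it.
∑ : {A : Set} {{_ : Finite A}} → (A → ℝ) → ℝ
∑ f = sum (f ∘ Inverse.to enum)

instance
  Finite-⊤ : Finite ⊤
  Finite-⊤ = record { enum = 1↔⊤ }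

  Finite-Sign : Finite Sign
  Finite-Sign = record { size = 2 ; enum = mk↔ₛ′
    (λ { zero → Sign.+ ; (suc zero) → Sign.- })
    (λ { Sign.+ → zero ; Sign.- → suc zero })
    (λ { Sign.+ → refl ; Sign.- → refl })
    (λ { zero → refl ; (suc zero) → refl }) }

  Finite-⊎ : {A B : Set} {{_ : Finite A}} {{_ : Finite B}} → Finite (A ⊎ B)
  Finite-⊎ = record { enum = ↔-trans +↔⊎ (enum ⊎-↔ enum) }

  Finite-× : {A B : Set} {{_ : Finite A}} {{_ : Finite B}} → Finite (A × B)
  Finite-× = record { enum = ↔-trans *↔× (enum ×-↔ enum) }

infix 4 _≋_

_≋_ : {A : Set} → Rel (A → ℝ) 0ℓ
x ≋ y = ∀ a → x a ≈ y a

Subset : Set → Set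
Subset A = A → Bool

infix 4 _∈ˢ_

_∈ˢ_ : {A : Set} → A → Subset A → Set
a ∈ˢ B = T (B a)

𝟏 : {A : Set} → Subset A → A → ℝ
𝟏 B a = if B a then 1ℝ else 0ℝ

conv : {A : Set} → Pred (A → ℝ) 0ℓ → Pred (A → ℝ) 0ℓ
conv {A} S x =
  ∃ λ m → Σ (Fin m → ℝ) λ c → Σ (Fin m → A → ℝ) λ pt →
    (∀ i → pt i ∈ S) ×
    (∀ i → 0ℝ ≤ c i) ×
    sum c ≈ 1ℝ ×
    x ≋ (λ a → sum (λ i → c i * pt i a))

image : {A B : Set} → ((A → ℝ) → (B → ℝ)) → Pred (A → ℝ) 0ℓ → Pred (B → ℝ) 0ℓ
image f S x = ∃ λ y → y ∈ S × f y ≋ x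

Matrix : Set → Set
Matrix A = A → A → ℝ

SymmetricMatrix : {A : Set} → Matrix A → Set
SymmetricMatrix M = ∀ a b → M a b ≈ M b a

PSD : {A : Set} {{_ : Finite A}} → Matrix A → Set
PSD {A} M = SymmetricMatrix M ×
  ((z : A → ℝ) → 0ℝ ≤ ∑ (λ a → ∑ (λ b → z a * M a b * z b)))

bordered : {A : Set} → (A → ℝ) → Matrix A → Matrix (⊤ ⊎ A)
bordered x X (inj₁ _) (inj₁ _) = 1ℝ
bordered x X (inj₁ _) (inj₂ b) = x b
bordered x X (inj₂ a) (inj₁ _) = x a
bordered x X (inj₂ a) (inj₂ b) = X a b

record SimpleGraph (V : Set) : Set₁ where
  field
    Adj        : Rel V 0ℓ
    adj-sym    : Symmetric Adj
    adj-irrefl : Irreflexive _≡_ Adj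

module _ {V : Set} (H : SimpleGraph V) where
  open SimpleGraph H

  Stable : Subset V → Set
  Stable I = ∀ {u v} → u ∈ˢ I → v ∈ˢ I → ¬ Adj u v

  Clique : Subset V → Set
  Clique K = ∀ {u v} → u ∈ˢ K → v ∈ˢ K → u ≢ v → Adj u v

  STAB : Pred (V → ℝ) 0ℓ
  STAB = conv λ y → ∃ λ I → Stable I × y ≋ 𝟏 I

  QSTAB : {{_ : Finite V}} → Pred (V → ℝ) 0ℓ
  QSTAB x = (∀ v → 0ℝ ≤ x v) ×
    (∀ K → Clique K → ∑ (λ v → if K v then x v else 0ℝ) ≤ 1ℝ)

  TH : {{_ : Finite V}} → Pred (V → ℝ) 0ℓ
  TH x = ∃ λ X →
    SymmetricMatrix X ×
    PSD (bordered x X) ×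
    (∀ v → X v v ≈ x v) ×
    (∀ {u v} → Adj u v → X u v ≈ 0ℝ)

-- Edge σ u v says that u and v are joined by an edge of sign σ; a digon is
-- a pair with both Edge + u v and Edge - u v.  Parallel edges of the same
-- sign are thereby identified.
record SignedGraph (V : Set) : Set₁ where
  field
    Edge        : Sign → Rel V 0ℓ
    edge-sym    : ∀ {σ} → Symmetric (Edge σ)
    no-neg-loop : Irreflexive _≡_ (Edge Sign.-)

open SignedGraph

completion : {V : Set} → SignedGraph V → SignedGraph V
completion S .Edge σ u v = Edge S σ u v ⊎ (σ ≡ Sign.+ × u ≡ v)
completion S .edge-sym (inj₁ e)           = inj₁ (edge-sym S e)
completion S .edge-sym (inj₂ (σ≡+ , u≡v)) = inj₂ (σ≡+ , sym u≡v)
completion S .no-neg-loop u≡v (inj₁ e)    = no-neg-loop S u≡v e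
completion S .no-neg-loop u≡v (inj₂ (() , _))

induced : {V : Set} → SignedGraph V → (B : Subset V) → SignedGraph (Σ V (_∈ˢ B))
induced S B .Edge σ          = Edge S σ on proj₁
induced S B .edge-sym        = edge-sym S
induced S B .no-neg-loop u≡v = no-neg-loop S (cong proj₁ u≡v)

next : ∀ {k} → Fin (ℕ.suc k) → Fin (ℕ.suc k)
next {k} i = ℕ.suc (toℕ i) mod ℕ.suc k

-- A cycle of length suc k: cyclically arranged distinct vertices, with
-- vertex i joined to vertex (next i) by an edge of sign sgn i, all edges
-- distinct.  Loops (length 1) and digons (length 2) are cycles, but going
-- back and forth along a single edge is not.
record Cycle {V : Set} (S : SignedGraph V) : Set where
  field
    k          : ℕ
    vertex     : Fin (ℕ.suc k) → V
    sgn        : Fin (ℕ.suc k) → Sign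
    edge       : ∀ i → Edge S (sgn i) (vertex i) (vertex (next i))
    vertex-inj : Injective _≡_ _≡_ vertex
    edge-inj   : ∀ {i j} → sgn i ≡ sgn j →
      (vertex i ≡ vertex j × vertex (next i) ≡ vertex (next j)) ⊎
      (vertex i ≡ vertex (next j) × vertex (next i) ≡ vertex j) →
      i ≡ j

cycleSign : {V : Set} {S : SignedGraph V} → Cycle S → Sign
cycleSign c = RawMonoidDefs.sum Sign.*-1-rawMonoid (Cycle.sgn c)

Balanced : {V : Set} → SignedGraph V → Set
Balanced S = (c : Cycle S) → cycleSign c ≡ Sign.+

private
  opposite-sym : ∀ σ s → s ≡ opposite σ Sign.* (opposite σ Sign.* s)
  opposite-sym Sign.- _      = refl
  opposite-sym Sign.+ Sign.- = refl
  opposite-sym Sign.+ Sign.+ = refl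

  opposite-fixed : ∀ σ s → s ≡ opposite σ Sign.* s → σ ≡ Sign.-
  opposite-fixed Sign.- _      _  = refl
  opposite-fixed Sign.+ Sign.- ()
  opposite-fixed Sign.+ Sign.+ ()

conflict : {V : Set} → SignedGraph V → SimpleGraph (V × Sign)
conflict S = record
  { Adj        = λ (u , s) (v , r) → ∃ λ σ → Edge S σ u v × r ≡ opposite σ Sign.* s
  ; adj-sym    = λ { {u , s} {v , _} (σ , e , refl) → σ , edge-sym S e , opposite-sym σ s }
  ; adj-irrefl = λ { {u , s} refl (σ , e , eq) →
      no-neg-loop S refl (subst (λ τ → Edge S τ u u) (opposite-fixed σ s eq) e) }
  }

p : {V : Set} → (V × Sign → ℝ) → (V → ℝ)
p y v = y (v , Sign.+) + y (v , Sign.-)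

module _ {V : Set} (S : SignedGraph V) where

  BSTAB : Pred (V → ℝ) 0ℓ
  BSTAB = conv λ y → ∃ λ B → Balanced (induced S B) × y ≋ 𝟏 B

  BTH : {{_ : Finite V}} → Pred (V → ℝ) 0ℓ
  BTH = image p (TH (conflict S))

  BQSTAB : {{_ : Finite V}} → Pred (V → ℝ) 0ℓ
  BQSTAB = image p (QSTAB (conflict S))

doubled : {V : Set} → SimpleGraph V → SignedGraph V
doubled G = record
  { Edge        = λ _ → SimpleGraph.Adj G
  ; edge-sym    = SimpleGraph.adj-sym G
  ; no-neg-loop = SimpleGraph.adj-irrefl G
  }

-- Every edge becomes a digon, and, as for all signed graphs considered,
-- each vertex gets a positive loop.
infix 9 _±

_± : {V : Set} → SimpleGraph V → SignedGraph V
G ± = completion (doubled G)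

{-# OPTIONS --safe #-}

-- In G ± the two signs of an edge impose the same constraint, so every
-- conflict between u and v in C(G ±) occurs for all four sign patterns, and
-- C(G ±) is the lexicographic product of G with K₂.  Solutions for G lift to
-- solutions for C(G ±) supported on the + layer; conversely, summing the two
-- layers (of a vector, or of the rows and columns of a matrix) projects
-- solutions for C(G ±) to solutions for G.  For BSTAB the generating sets
-- already agree: a digon is a negative cycle, and the only cycles left in a
-- stable set are positive loops.

module Submission where

open import Defs
open import Algebra.Bundles using (CommutativeMonoid)
import Algebra.Properties.CommutativeMonoid.Sum as CommutativeMonoidSum
import Algebra.Properties.Monoid.Sum as MonoidSum
open import Data.Bool.Base using (true; false; if_then_else_)
open import Data.Fin.Base using (Fin; zero; suc; splitAt; quotRem; remQuot)
open import Data.Fin.Properties using (inj⇒≟)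
open import Data.Nat.Base as ℕ using (ℕ; _⊔_)
import Data.Nat.Properties as ℕ
open import Data.Product.Base as Product using (Σ; ∃; _×_; _,_; proj₁; proj₂; swap)
open import Data.Rational.Base as ℚ using (ℚ; 0ℚ; 1ℚ; ½; ∣_∣)
import Data.Rational.Properties as ℚ
open import Data.Rational.Solver using (module +-*-Solver)
open import Data.Sign.Base as Sign using (Sign)
import Data.Sign.Properties as Sign
open import Data.Sum.Base using (_⊎_; inj₁; inj₂; [_,_]′; map₁; map₂)
open import Data.Unit.Base using (⊤)
open import Function.Base using (_∘_)
open import Function.Bundles using (Inverse)
open import Function.Properties.Inverse using (↔-sym; ↔⇒↣)
open import Level using (0ℓ)
open import Relation.Binary.Definitions using (DecidableEquality)
open import Relation.Binary.PropositionalEquality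
  using (_≡_; refl; sym; trans; cong; subst)
import Relation.Binary.Reasoning.Setoid as SetoidReasoning
open import Relation.Nullary.Decidable using (yes; no)
open import Relation.Nullary.Negation using (contradiction)
open import Relation.Unary using (Pred; _⊆_; _≐_)

open +-*-Solver using (solve; _:=_; _:+_; _:*_; _:-_; :-_; con)

-- Real arithmetic

Eventually : (ℕ → Set) → Set
Eventually P = ∃ λ N → ∀ {n} → N ℕ.≤ n → P n

eventually-zip : {P Q R : ℕ → Set} → (∀ {n} → P n → Q n → R n) →
  Eventually P → Eventually Q → Eventually R
eventually-zip f (M , P) (N , Q) = M ⊔ N , λ ≤n →
  f (P (ℕ.m⊔n≤o⇒m≤o M N ≤n)) (Q (ℕ.m⊔n≤o⇒n≤o M N ≤n))

eventually-map : {P Q : ℕ → Set} → (∀ {n} → P n → Q n) → Eventually P → Eventually Q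
eventually-map f (N , P) = N , λ N≤n → f (P N≤n)

half-pos : ∀ {ε} → 0ℚ ℚ.< ε → 0ℚ ℚ.< ε ℚ.* ½
half-pos {ε} ε>0 = ℚ.positive⁻¹ (ε ℚ.* ½) {{ℚ.pos*pos⇒pos ε {{ℚ.positive ε>0}} ½}}

half+half : ∀ ε → ε ℚ.* ½ ℚ.+ ε ℚ.* ½ ≡ ε
half+half = solve 1 (λ ε → ε :* con ½ :+ ε :* con ½ := ε) refl

p≤∣p∣ : ∀ q → q ℚ.≤ ∣ q ∣
p≤∣p∣ q with ℚ.≤-total 0ℚ q
... | inj₁ 0≤q = ℚ.≤-reflexive (sym (ℚ.0≤p⇒∣p∣≡p 0≤q))
... | inj₂ q≤0 = ℚ.≤-trans q≤0 (ℚ.0≤∣p∣ q)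

∣-∣-sum-< : ∀ {q r s ε} → q ≡ r ℚ.+ s → ∣ r ∣ ℚ.< ε ℚ.* ½ → ∣ s ∣ ℚ.< ε ℚ.* ½ → ∣ q ∣ ℚ.< ε
∣-∣-sum-< {q} {r} {s} {ε} refl r< s< = begin-strict
  ∣ r ℚ.+ s ∣          ≤⟨ ℚ.∣p+q∣≤∣p∣+∣q∣ r s ⟩
  ∣ r ∣ ℚ.+ ∣ s ∣      <⟨ ℚ.+-mono-< r< s< ⟩
  ε ℚ.* ½ ℚ.+ ε ℚ.* ½  ≡⟨ half+half ε ⟩
  ε                    ∎
  where open ℚ.≤-Reasoning

-- Since x ≈ y unfolds to a function type, its endpoints could not be inferred;
-- the wrapper makes them inferable.
infix 4 _≃_

record _≃_ (x y : ℝ) : Set where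
  constructor ≈⇒≃
  field
    ≃⇒≈ : x ≈ y

open _≃_

-- As `_+_` and `_*_` act termwise on sequences, polynomial identities over `ℚ` carry over to `ℝ` in
-- this way.
termwise : ∀ {x y} → (∀ n → seq x n ≡ seq y n) → x ≃ y
termwise {x} {y} eq .≃⇒≈ {ε} ε>0 = 0 , λ {n} _ → subst (λ q → ∣ q ∣ ℚ.< ε)
  (sym (trans (cong (ℚ._- seq y n) (eq n)) (ℚ.+-inverseʳ (seq y n)))) ε>0

≃-refl : ∀ {x} → x ≃ x
≃-refl = termwise λ _ → refl

≃-sym : ∀ {x y} → x ≃ y → y ≃ x
≃-sym {x} {y} (≈⇒≃ x≈y) .≃⇒≈ {ε} ε>0 =
  eventually-map (λ {n} → subst (ℚ._< ε) (∣-∣-comm (seq x n) (seq y n))) (x≈y ε>0)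
  where
  ∣-∣-comm : ∀ q r → ∣ q ℚ.- r ∣ ≡ ∣ r ℚ.- q ∣
  ∣-∣-comm q r = trans (cong ∣_∣ (solve 2 (λ q r → q :- r := :- (r :- q)) refl q r))
                       (ℚ.∣-p∣≡∣p∣ (r ℚ.- q))

≃-trans : ∀ {x y z} → x ≃ y → y ≃ z → x ≃ z
≃-trans {x} {y} {z} (≈⇒≃ x≈y) (≈⇒≃ y≈z) .≃⇒≈ {ε} ε>0 =
  eventually-zip (λ {n} → ∣-∣-sum-< (split (seq x n) (seq y n) (seq z n)))
    (x≈y (half-pos ε>0)) (y≈z (half-pos ε>0))
  where
  split : ∀ q r s → q ℚ.- s ≡ (q ℚ.- r) ℚ.+ (r ℚ.- s)
  split = solve 3 (λ q r s → q :- s := (q :- r) :+ (r :- s)) refl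

+-cong : ∀ {x x′ y y′} → x ≃ x′ → y ≃ y′ → x + y ≃ x′ + y′
+-cong {x} {x′} {y} {y′} (≈⇒≃ x≈x′) (≈⇒≃ y≈y′) .≃⇒≈ ε>0 =
  eventually-zip (λ {n} → ∣-∣-sum-< (split (seq x n) (seq y n) (seq x′ n) (seq y′ n)))
    (x≈x′ (half-pos ε>0)) (y≈y′ (half-pos ε>0))
  where
  split : ∀ q r s t → (q ℚ.+ r) ℚ.- (s ℚ.+ t) ≡ (q ℚ.- s) ℚ.+ (r ℚ.- t)
  split = solve 4 (λ q r s t → (q :+ r) :- (s :+ t) := (q :- s) :+ (r :- t)) refl

eventually-bounded : ∀ x → ∃ λ B → 0ℚ ℚ.< B × Eventually (λ n → ∣ seq x n ∣ ℚ.< B)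
eventually-bounded x with cauchy x (ℚ.positive⁻¹ 1ℚ)
... | N , close = 1ℚ ℚ.+ ∣ a N ∣ , ℚ.+-mono-<-≤ (ℚ.positive⁻¹ 1ℚ) (ℚ.0≤∣p∣ (a N)) , N , bound
  where
  a = seq x
  open ℚ.≤-Reasoning
  bound : ∀ {n} → N ℕ.≤ n → ∣ a n ∣ ℚ.< 1ℚ ℚ.+ ∣ a N ∣
  bound {n} N≤n = begin-strict
    ∣ a n ∣                      ≡⟨ cong ∣_∣ (solve 2 (λ q r → q := (q :- r) :+ r) refl (a n) (a N)) ⟩
    ∣ (a n ℚ.- a N) ℚ.+ a N ∣    ≤⟨ ℚ.∣p+q∣≤∣p∣+∣q∣ (a n ℚ.- a N) (a N) ⟩
    ∣ a n ℚ.- a N ∣ ℚ.+ ∣ a N ∣  <⟨ ℚ.+-monoˡ-< ∣ a N ∣ (close N≤n ℕ.≤-refl) ⟩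
    1ℚ ℚ.+ ∣ a N ∣               ∎

quotient : ∀ {q r} → 0ℚ ℚ.< q → 0ℚ ℚ.< r → ∃ λ d → 0ℚ ℚ.< d × d ℚ.* r ≡ q
quotient {q} {r} q>0 r>0 = q ℚ.* ℚ.1/ r
  , ℚ.positive⁻¹ (q ℚ.* ℚ.1/ r) {{ℚ.pos*pos⇒pos q {{ℚ.positive q>0}} (ℚ.1/ r) {{ℚ.1/pos⇒pos r}}}}
  , trans (ℚ.*-assoc q (ℚ.1/ r) r)
      (trans (cong (q ℚ.*_) (ℚ.*-inverseˡ r)) (ℚ.*-identityʳ q))
  where
  instance
    r-pos : ℚ.Positive r
    r-pos = ℚ.positive r>0
    r-nz : ℚ.NonZero r
    r-nz = ℚ.pos⇒nonZero r

∣*-diff∣-< : ∀ {a a′ b δ B} → 0ℚ ℚ.< B → ∣ a ℚ.- a′ ∣ ℚ.< δ → ∣ b ∣ ℚ.< B →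
  ∣ a ℚ.* b ℚ.- a′ ℚ.* b ∣ ℚ.< δ ℚ.* B
∣*-diff∣-< {a} {a′} {b} {δ} {B} B>0 d<δ b<B = begin-strict
  ∣ a ℚ.* b ℚ.- a′ ℚ.* b ∣
    ≡⟨ cong ∣_∣ (solve 3 (λ q r s → q :* s :- r :* s := (q :- r) :* s) refl a a′ b) ⟩
  ∣ (a ℚ.- a′) ℚ.* b ∣
    ≡⟨ ℚ.∣p*q∣≡∣p∣*∣q∣ (a ℚ.- a′) b ⟩
  ∣ a ℚ.- a′ ∣ ℚ.* ∣ b ∣
    -- Only weak, because `∣ a ℚ.- a′ ∣` may vanish; strictness comes from scaling `d<δ` by the
    -- positive `B` next.
    ≤⟨ ℚ.*-monoˡ-≤-nonNeg ∣ a ℚ.- a′ ∣ {{ℚ.∣-∣-nonNeg (a ℚ.- a′)}} (ℚ.<⇒≤ b<B) ⟩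
  ∣ a ℚ.- a′ ∣ ℚ.* B
    <⟨ ℚ.*-monoˡ-<-pos B {{ℚ.positive B>0}} d<δ ⟩
  δ ℚ.* B ∎
  where open ℚ.≤-Reasoning

*-congʳ : ∀ {x y y′} → y ≃ y′ → y * x ≃ y′ * x
*-congʳ {x} {y} {y′} (≈⇒≃ y≈y′) .≃⇒≈ {ε} ε>0 =
  -- The common factor `x` is eventually bounded by `B`, so it suffices that `y` and `y′` differ by
  -- less than `δ = ε / B`.
  let B , B>0 , x<B    = eventually-bounded x
      δ , δ>0 , δ*B≡ε  = quotient {ε} {B} ε>0 B>0
  in eventually-zip
       (λ {n} d<δ b<B → subst (∣ seq y n ℚ.* seq x n ℚ.- seq y′ n ℚ.* seq x n ∣ ℚ.<_) δ*B≡ε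
         (∣*-diff∣-< {seq y n} {seq y′ n} {seq x n} {δ} {B} B>0 d<δ b<B))
       (y≈y′ δ>0) x<B

*-comm : ∀ x y → x * y ≃ y * x
*-comm x y = termwise λ n → ℚ.*-comm (seq x n) (seq y n)

*-congˡ : ∀ {x y y′} → y ≃ y′ → x * y ≃ x * y′
*-congˡ {x} {y} {y′} y≃y′ =
  ≃-trans (*-comm x y) (≃-trans (*-congʳ {x} y≃y′) (*-comm y′ x))

+-0-commutativeMonoid : CommutativeMonoid 0ℓ 0ℓ
+-0-commutativeMonoid = record
  { Carrier = ℝ
  ; _≈_     = _≃_
  ; _∙_     = _+_
  ; ε       = 0ℝ
  ; isCommutativeMonoid = record
    { isMonoid = record
      { isSemigroup = record
        { isMagma = record
          { isEquivalence = record { refl = ≃-refl ; sym = ≃-sym ; trans = ≃-trans }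
          ; ∙-cong        = +-cong
          }
        ; assoc = λ x y z → termwise λ n → ℚ.+-assoc (seq x n) (seq y n) (seq z n)
        }
      ; identity = (λ x → termwise λ n → ℚ.+-identityˡ (seq x n))
                 , (λ x → termwise λ n → ℚ.+-identityʳ (seq x n))
      }
    ; comm = λ x y → termwise λ n → ℚ.+-comm (seq x n) (seq y n)
    }
  }

open CommutativeMonoid +-0-commutativeMonoid using (setoid)
  renaming (identityˡ to +-identityˡ; identityʳ to +-identityʳ; assoc to +-assoc;
            ∙-congˡ to +-congˡ)
open CommutativeMonoidSum +-0-commutativeMonoid using (sum-cong-≋; ∑-distrib-+; ∑-comm)
open SetoidReasoning setoid

-- Each comparison gets half of `ε`. The reals are explicit because `_≤_` unfolds to a function
-- type, from which they could not be inferred.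
≤-trans : ∀ x y z → x ≤ y → y ≤ z → x ≤ z
≤-trans x y z x≤y y≤z {ε} ε>0 =
  eventually-zip (λ {n} → chain {seq x n} {seq y n} {seq z n}) (x≤y (half-pos ε>0)) (y≤z (half-pos ε>0))
  where
  chain : ∀ {q r s} → q ℚ.< r ℚ.+ ε ℚ.* ½ → r ℚ.< s ℚ.+ ε ℚ.* ½ → q ℚ.< s ℚ.+ ε
  chain {q} {r} {s} q<r r<s = ℚ.<-trans q<r (subst (r ℚ.+ ε ℚ.* ½ ℚ.<_)
    (trans (ℚ.+-assoc s (ε ℚ.* ½) (ε ℚ.* ½)) (cong (s ℚ.+_) (half+half ε)))
    (ℚ.+-monoˡ-< (ε ℚ.* ½) r<s))

≤-reflexive : ∀ {x y} → x ≃ y → x ≤ y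
≤-reflexive {x} {y} (≈⇒≃ x≈y) {ε} ε>0 = eventually-map (λ {n} → shift {seq x n} {seq y n}) (x≈y ε>0)
  where
  shift : ∀ {q r} → ∣ q ℚ.- r ∣ ℚ.< ε → q ℚ.< r ℚ.+ ε
  shift {q} {r} d<ε = subst (ℚ._< r ℚ.+ ε)
    (solve 2 (λ q r → r :+ (q :- r) := q) refl q r)
    (ℚ.+-monoʳ-< r (ℚ.≤-<-trans (p≤∣p∣ (q ℚ.- r)) d<ε))

≤-respʳ : ∀ x {y y′} → y ≃ y′ → x ≤ y → x ≤ y′
≤-respʳ x {y} {y′} y≃y′ x≤y = ≤-trans x y y′ x≤y (≤-reflexive y≃y′)

≤-respˡ : ∀ y {x x′} → x ≃ x′ → x ≤ y → x′ ≤ y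
≤-respˡ y {x} {x′} x≃x′ x≤y = ≤-trans x′ x y (≤-reflexive (≃-sym x≃x′)) x≤y

+-nonNeg : ∀ x y → 0ℝ ≤ x → 0ℝ ≤ y → 0ℝ ≤ x + y
+-nonNeg x y 0≤x 0≤y {ε} ε>0 =
  eventually-zip (λ {n} → add {seq x n} {seq y n}) (0≤x (half-pos ε>0)) (0≤y (half-pos ε>0))
  where
  regroup : ∀ q r s → (q ℚ.+ s) ℚ.+ (r ℚ.+ s) ≡ (q ℚ.+ r) ℚ.+ (s ℚ.+ s)
  regroup = solve 3 (λ q r s → (q :+ s) :+ (r :+ s) := (q :+ r) :+ (s :+ s)) refl
  add : ∀ {q r} → 0ℚ ℚ.< q ℚ.+ ε ℚ.* ½ → 0ℚ ℚ.< r ℚ.+ ε ℚ.* ½ → 0ℚ ℚ.< q ℚ.+ r ℚ.+ ε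
  add {q} {r} 0<q 0<r = subst (0ℚ ℚ.<_)
    (trans (regroup q r (ε ℚ.* ½)) (cong (q ℚ.+ r ℚ.+_) (half+half ε)))
    (ℚ.+-mono-< 0<q 0<r)

-- Sums over finite types

∑-cong : {A : Set} {{_ : Finite A}} {f g : A → ℝ} → (∀ a → f a ≃ g a) → ∑ f ≃ ∑ g
∑-cong f≃g = sum-cong-≋ (f≃g ∘ Inverse.to enum)

sum-splitAt : ∀ m {n} (f : Fin m ⊎ Fin n → ℝ) →
  sum (f ∘ splitAt m) ≃ sum (f ∘ inj₁) + sum (f ∘ inj₂)
sum-splitAt ℕ.zero    f = ≃-sym (+-identityˡ _)
sum-splitAt (ℕ.suc m) f = ≃-trans
  (+-congˡ (sum-splitAt m (f ∘ map₁ suc)))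
  (≃-sym (+-assoc _ _ _))

sum-remQuot : ∀ m {n} (f : Fin m × Fin n → ℝ) →
  sum (f ∘ remQuot {m} n) ≃ sum λ i → sum λ j → f (i , j)
sum-remQuot ℕ.zero        f = ≃-refl
sum-remQuot (ℕ.suc m) {n} f = ≃-trans
  -- This argument is `f ∘ remQuot n` stripped of its leading `splitAt n`: the first `n` indices
  -- form row zero, and the rest are divided recursively.
  (sum-splitAt n (f ∘ swap ∘ [ (_, zero) , Product.map₂ suc ∘ quotRem {m} n ]′))
  (+-congˡ (sum-remQuot m λ (i , j) → f (suc i , j)))

∑-× : {A B : Set} {{_ : Finite A}} {{_ : Finite B}} (f : A × B → ℝ) →
  ∑ f ≃ ∑ λ a → ∑ λ b → f (a , b)
∑-× {{A}} f = sum-remQuot (size {{A}}) λ (i , j) → f (Inverse.to enum i , Inverse.to enum j)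

∑∑-comm : {A B : Set} {{_ : Finite A}} {{_ : Finite B}} (f : A → B → ℝ) →
  (∑ λ a → ∑ λ b → f a b) ≃ ∑ λ b → ∑ λ a → f a b
∑∑-comm f = ∑-comm λ i j → f (Inverse.to enum i) (Inverse.to enum j)

∑-p : {V : Set} {{_ : Finite V}} (f : V × Sign → ℝ) → ∑ f ≃ ∑ (p f)
-- A sum over `Sign` unfolds to the `Sign.+` term, the `Sign.-` term and a final `0ℝ`, which
-- `+-identityʳ` removes.
∑-p f = ≃-trans (∑-× f) (∑-cong λ v → +-congˡ {f (v , Sign.+)} (+-identityʳ (f (v , Sign.-))))

-- The pushforward along `map₂ proj₁`: the border index is kept and the two signed copies of each
-- vertex are merged.
collapse : {V : Set} → (⊤ ⊎ V × Sign → ℝ) → ⊤ ⊎ V → ℝ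
collapse f (inj₁ t) = f (inj₁ t)
collapse f (inj₂ v) = p (f ∘ inj₂) v

∑-collapse : {V : Set} {{_ : Finite V}} (f : ⊤ ⊎ V × Sign → ℝ) → ∑ f ≃ ∑ (collapse f)
∑-collapse f = +-congˡ (∑-p (f ∘ inj₂))

collapse² : {V : Set} → (⊤ ⊎ V × Sign → ⊤ ⊎ V × Sign → ℝ) → ⊤ ⊎ V → ⊤ ⊎ V → ℝ
collapse² F u v = collapse (λ a → collapse (F a) v) u

-- With `F` the terms of a quadratic form, this reduces comparing the forms of the large and the
-- small bordered matrix to comparing single entries.
∑∑-collapse : {V : Set} {{_ : Finite V}} (F : ⊤ ⊎ V × Sign → ⊤ ⊎ V × Sign → ℝ) →
  (∑ λ a → ∑ λ b → F a b) ≃ ∑ λ u → ∑ λ v → collapse² F u v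
∑∑-collapse F = begin
  (∑ λ a → ∑ λ b → F a b)             ≈⟨ ∑-cong (λ a → ∑-collapse (F a)) ⟩
  -- The interchange moves the sum over `a` inside, where `∑-collapse` applies for each fixed `v`.
  (∑ λ a → ∑ λ v → collapse (F a) v)  ≈⟨ ∑∑-comm (λ a v → collapse (F a) v) ⟩
  (∑ λ v → ∑ λ a → collapse (F a) v)  ≈⟨ ∑-cong (λ v → ∑-collapse λ a → collapse (F a) v) ⟩
  (∑ λ v → ∑ λ u → collapse² F u v)   ≈⟨ ∑∑-comm (λ v u → collapse² F u v) ⟩
  (∑ λ u → ∑ λ v → collapse² F u v)   ∎

-- Comparing indices in the enumeration decides equality; this lets a pair in the conflict graph be
-- sorted into one fibre or two.
Finite⇒≟ : {V : Set} {{_ : Finite V}} → DecidableEquality V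
Finite⇒≟ = inj⇒≟ (↔⇒↣ (↔-sym enum))

conv-mono : {A : Set} (S T : Pred (A → ℝ) 0ℓ) → S ⊆ T → conv S ⊆ conv T
conv-mono S T S⊆T (m , c , pt , pt∈S , rest) = m , c , pt , (λ i → S⊆T {pt i} (pt∈S i)) , rest

module _ {V : Set} (G : SimpleGraph V) where
  open SimpleGraph G
  open Cycle

  -- Balanced sets of `G ±` and stable sets of `G`

  stable⇒balanced : ∀ {B} → Stable G B → Balanced (induced (G ±) B)
  stable⇒balanced stable c = trans (sum-cong-≗ positive) (sum-replicate-zero (ℕ.suc (k c)))
    where
    open MonoidSum Sign.*-monoid using (sum-cong-≗; sum-replicate-zero)
    positive : ∀ i → sgn c i ≡ Sign.+
    -- Both ends lie in `B`, so stability excludes edges of `G`; what remains are the positive loops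
    -- of the completion.
    positive i with edge c i
    ... | inj₁ adj       = contradiction adj (stable (proj₂ (vertex c i)) (proj₂ (vertex c (next i))))
    ... | inj₂ (σ≡+ , _) = σ≡+

  digon : ∀ {B u v} → u ∈ˢ B → v ∈ˢ B → Adj u v → Cycle (induced (G ±) B)
  digon {B} {u} {v} u∈B v∈B adj = record
    { k          = 1
    ; vertex     = ends
    ; sgn        = signs
    -- On `Fin 2`, `next` swaps the two indices, so the second edge runs from `v` back to `u`.
    ; edge       = λ { zero → inj₁ adj ; (suc zero) → inj₁ (adj-sym adj) }
    ; vertex-inj = λ
      { {zero}     {zero}     _  → refl
      ; {zero}     {suc zero} eq → contradiction adj (adj-irrefl (cong proj₁ eq))
      ; {suc zero} {zero}     eq → contradiction adj (adj-irrefl (cong proj₁ (sym eq)))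
      ; {suc zero} {suc zero} _  → refl
      }
    ; edge-inj   = λ
      { {zero}     {zero}     _  _ → refl
      -- The two edges share their ends and are told apart by their signs alone.
      ; {zero}     {suc zero} () _
      ; {suc zero} {zero}     () _
      ; {suc zero} {suc zero} _  _ → refl
      }
    }
    where
    ends : Fin 2 → Σ V (_∈ˢ B)
    ends zero       = u , u∈B
    ends (suc zero) = v , v∈B
    signs : Fin 2 → Sign
    signs zero       = Sign.+
    signs (suc zero) = Sign.-

  balanced⇒stable : ∀ {B} → Balanced (induced (G ±) B) → Stable G B
  balanced⇒stable balanced u∈B v∈B adj with balanced (digon u∈B v∈B adj)
  -- The sign of the digon computes to `Sign.-`.
  ... | ()

  BSTAB-± : BSTAB (G ±) ≐ STAB G
  BSTAB-± =
      (λ {x} → conv-mono balanced-𝟏 stable-𝟏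
        (λ (B , balanced , y≋𝟏B) → B , balanced⇒stable balanced , y≋𝟏B) {x})
    , (λ {x} → conv-mono stable-𝟏 balanced-𝟏
        (λ (I , stable , y≋𝟏I) → I , stable⇒balanced stable , y≋𝟏I) {x})
    where
    balanced-𝟏 stable-𝟏 : Pred (V → ℝ) 0ℓ
    balanced-𝟏 y = ∃ λ B → Balanced (induced (G ±) B) × y ≋ 𝟏 B
    stable-𝟏   y = ∃ λ I → Stable G I × y ≋ 𝟏 I

  -- Adjacency in the conflict graph

  C : SimpleGraph (V × Sign)
  C = conflict (G ±)

  private module C = SimpleGraph C

  -- The equation `r = -σs` forces `σ = -sr`, and the digon has an edge of either sign.
  conflict-adj : ∀ {u v} s r → Adj u v → C.Adj (u , s) (v , r)
  conflict-adj Sign.+ Sign.+ adj = Sign.- , inj₁ adj , refl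
  conflict-adj Sign.+ Sign.- adj = Sign.+ , inj₁ adj , refl
  conflict-adj Sign.- Sign.+ adj = Sign.+ , inj₁ adj , refl
  conflict-adj Sign.- Sign.- adj = Sign.- , inj₁ adj , refl

  -- This is where completion enters: a positive loop makes each fibre of `proj₁` a clique.
  conflict-loop : ∀ v s → C.Adj (v , s) (v , Sign.opposite s)
  conflict-loop v Sign.+ = Sign.+ , inj₂ (refl , refl) , refl
  conflict-loop v Sign.- = Sign.+ , inj₂ (refl , refl) , refl

  -- A positive loop reverses the sign, so a conflict within one layer must come from an edge of
  -- `G`.
  conflict-layer : ∀ {u v s} → C.Adj (u , s) (v , s) → Adj u v
  conflict-layer (_ , inj₁ adj , _) = adj
  conflict-layer {s = Sign.+} (_ , inj₂ (refl , _) , ())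
  conflict-layer {s = Sign.-} (_ , inj₂ (refl , _) , ())

  layer⁺ : (V → ℝ) → V × Sign → ℝ
  layer⁺ x (v , Sign.+) = x v
  layer⁺ x (v , Sign.-) = 0ℝ

  p-layer⁺ : ∀ x → p (layer⁺ x) ≋ x
  p-layer⁺ x v = ≃⇒≈ (+-identityʳ (x v))

  layer⁺² : Matrix V → Matrix (V × Sign)
  layer⁺² X (u , Sign.+) (v , Sign.+) = X u v
  layer⁺² X (u , Sign.+) (v , Sign.-) = 0ℝ
  layer⁺² X (u , Sign.-) (v , _)      = 0ℝ

  -- If `P` is the matrix of `p`, this is the product of `P`, `Y` and the transpose of `P`, which
  -- explains why positive semidefiniteness survives.
  p² : Matrix (V × Sign) → Matrix V
  p² Y u v = p (λ a → p (Y a) v) u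

  -- The clique-constrained bodies

  module _ {{_ : Finite V}} where

    -- The full preimage of a clique `K` under `proj₁` is a clique of `C`, and its constraint on `y`
    -- is the constraint of `K` on `p y`.
    BQSTAB⊆QSTAB : BQSTAB (G ±) ⊆ QSTAB G
    BQSTAB⊆QSTAB {x} (y , (y≥0 , y-clique) , py≈x) = x≥0 , x-clique
      where
      py≃x : ∀ v → p y v ≃ x v
      py≃x v = ≈⇒≃ (py≈x v)

      x≥0 : ∀ v → 0ℝ ≤ x v
      x≥0 v = ≤-respʳ 0ℝ (py≃x v)
        (+-nonNeg (y (v , Sign.+)) (y (v , Sign.-)) (y≥0 (v , Sign.+)) (y≥0 (v , Sign.-)))

      x-clique : ∀ K → Clique G K → ∑ (λ v → if K v then x v else 0ℝ) ≤ 1ℝ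
      x-clique K clique = ≤-respˡ 1ℝ
        (≃-trans (∑-p λ (v , s) → if K v then y (v , s) else 0ℝ) (∑-cong restrict))
        (y-clique (K ∘ proj₁) λ {a} {b} → K×±-clique {a} {b})
        where
        restrict : ∀ v → p (λ (v , s) → if K v then y (v , s) else 0ℝ) v
                       ≃ (if K v then x v else 0ℝ)
        restrict v with K v
        ... | true  = py≃x v
        ... | false = +-identityʳ 0ℝ

        K×±-clique : Clique C (K ∘ proj₁)
        K×±-clique {u , s} {v , r} u∈K v∈K us≢vr with Finite⇒≟ u v
        ... | no u≢v = conflict-adj s r (clique u∈K v∈K u≢v)
        -- Over a single vertex, distinct elements have opposite signs and the loop joins them.
        K×±-clique {v , Sign.+} {v , Sign.+} _ _ us≢vr | yes refl = contradiction refl us≢vr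
        K×±-clique {v , Sign.+} {v , Sign.-} _ _ _     | yes refl = conflict-loop v Sign.+
        K×±-clique {v , Sign.-} {v , Sign.+} _ _ _     | yes refl = conflict-loop v Sign.-
        K×±-clique {v , Sign.-} {v , Sign.-} _ _ us≢vr | yes refl = contradiction refl us≢vr

    -- A clique of `C` meets the + layer in a clique of `G`, and its remaining elements have weight
    -- zero.
    QSTAB⊆BQSTAB : QSTAB G ⊆ BQSTAB (G ±)
    QSTAB⊆BQSTAB {x} (x≥0 , x-clique) = layer⁺ x , (y≥0 , y-clique) , p-layer⁺ x
      where
      y≥0 : ∀ a → 0ℝ ≤ layer⁺ x a
      y≥0 (v , Sign.+) = x≥0 v
      y≥0 (v , Sign.-) = ≤-reflexive {0ℝ} ≃-refl

      y-clique : ∀ K → Clique C K → ∑ (λ a → if K a then layer⁺ x a else 0ℝ) ≤ 1ℝ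
      y-clique K clique = ≤-respˡ 1ℝ
        (≃-sym (≃-trans (∑-p λ a → if K a then layer⁺ x a else 0ℝ) (∑-cong drop⁻)))
        (x-clique (λ v → K (v , Sign.+))
          λ u∈K v∈K u≢v → conflict-layer (clique u∈K v∈K (u≢v ∘ cong proj₁)))
        where
        drop⁻ : ∀ v → p (λ a → if K a then layer⁺ x a else 0ℝ) v
                    ≃ (if K (v , Sign.+) then x v else 0ℝ)
        -- Whether or not `(v , Sign.-)` lies in `K`, its summand is `0ℝ`.
        drop⁻ v with K (v , Sign.-)
        ... | true  = +-identityʳ _
        ... | false = +-identityʳ _

    -- The theta bodies

    BTH⊆TH : BTH (G ±) ⊆ TH G
    BTH⊆TH {x} (y , (Y , Y-sym , (_ , Y-psd) , Y-diag , Y-edge) , py≈x) =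
      X , (λ u v → ≃⇒≈ (X-sym u v)) , (bordered-sym , psd) , diag , edge-zero
      where
      py≃x : ∀ v → p y v ≃ x v
      py≃x v = ≈⇒≃ (py≈x v)

      X : Matrix V
      X = p² Y

      X-sym : ∀ u v → X u v ≃ X v u
      X-sym u v = ≃-trans
        (+-cong (+-cong (≈⇒≃ (Y-sym (u , Sign.+) (v , Sign.+))) (≈⇒≃ (Y-sym (u , Sign.+) (v , Sign.-))))
                (+-cong (≈⇒≃ (Y-sym (u , Sign.-) (v , Sign.+))) (≈⇒≃ (Y-sym (u , Sign.-) (v , Sign.-)))))
        -- After `Y-sym`, the four block entries only have their two middle terms in the wrong
        -- order.
        (transpose (Y (v , Sign.+) (u , Sign.+)) (Y (v , Sign.-) (u , Sign.+))
                   (Y (v , Sign.+) (u , Sign.-)) (Y (v , Sign.-) (u , Sign.-)))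
        where
        transpose : ∀ a b c d → (a + b) + (c + d) ≃ (a + c) + (b + d)
        transpose a b c d = termwise λ n →
          solve 4 (λ a b c d → (a :+ b) :+ (c :+ d) := (a :+ c) :+ (b :+ d)) refl
            (seq a n) (seq b n) (seq c n) (seq d n)

      bordered-sym : SymmetricMatrix (bordered x X)
      bordered-sym (inj₁ _) (inj₁ _) = ≃⇒≈ {1ℝ} ≃-refl
      bordered-sym (inj₁ _) (inj₂ v) = ≃⇒≈ {x v} ≃-refl
      bordered-sym (inj₂ u) (inj₁ _) = ≃⇒≈ {x u} ≃-refl
      bordered-sym (inj₂ u) (inj₂ v) = ≃⇒≈ (X-sym u v)

      diag : ∀ v → X v v ≈ x v
      diag v = ≃⇒≈ (begin
        -- The entries between `(v , Sign.+)` and `(v , Sign.-)` vanish by `conflict-loop`, so the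
        -- block sum equals the sum of its diagonal.
        X v v ≈⟨ +-cong (+-cong (≈⇒≃ (Y-diag (v , Sign.+))) (≈⇒≃ (Y-edge (conflict-loop v Sign.+))))
                        (+-cong (≈⇒≃ (Y-edge (conflict-loop v Sign.-))) (≈⇒≃ (Y-diag (v , Sign.-)))) ⟩
        (y (v , Sign.+) + 0ℝ) + (0ℝ + y (v , Sign.-))
              ≈⟨ +-cong (+-identityʳ (y (v , Sign.+))) (+-identityˡ (y (v , Sign.-))) ⟩
        p y v ≈⟨ py≃x v ⟩
        x v   ∎)

      edge-zero : ∀ {u v} → Adj u v → X u v ≈ 0ℝ
      edge-zero {u} {v} adj = ≃⇒≈ {X u v} {0ℝ} (≃-trans
        (+-cong (+-cong (zero-at Sign.+ Sign.+) (zero-at Sign.+ Sign.-))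
                (+-cong (zero-at Sign.- Sign.+) (zero-at Sign.- Sign.-)))
        (termwise λ _ → refl))
        where
        zero-at : ∀ s r → Y (u , s) (v , r) ≃ 0ℝ
        zero-at s r = ≈⇒≃ (Y-edge (conflict-adj s r adj))

      psd : ∀ z → 0ℝ ≤ ∑ λ u → ∑ λ v → z u * bordered x X u v * z v
      psd z = ≤-respʳ 0ℝ
        (≃-trans (∑∑-collapse λ a b → z (π a) * bordered y Y a b * z (π b))
                 (∑-cong λ u → ∑-cong λ v → entry u v))
        -- The test vector `z ∘ π` is constant on fibres, so its coefficients factor out of each
        -- block sum.
        (Y-psd (z ∘ π))
        where
        π : ⊤ ⊎ V × Sign → ⊤ ⊎ V
        π = map₂ proj₁

        distrib : ∀ a b c d → a * b * d + a * c * d ≃ a * (b + c) * d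
        distrib a b c d = termwise λ n →
          solve 4 (λ a b c d → a :* b :* d :+ a :* c :* d := a :* (b :+ c) :* d) refl
            (seq a n) (seq b n) (seq c n) (seq d n)

        entry : ∀ u v → collapse² (λ a b → z (π a) * bordered y Y a b * z (π b)) u v
                      ≃ z u * bordered x X u v * z v
        entry (inj₁ _) (inj₁ _) = ≃-refl
        entry (inj₁ t) (inj₂ v) = ≃-trans
          (distrib (z (inj₁ t)) (y (v , Sign.+)) (y (v , Sign.-)) (z (inj₂ v)))
          (*-congʳ (*-congˡ {z (inj₁ t)} (py≃x v)))
        entry (inj₂ u) (inj₁ t) = ≃-trans
          (distrib (z (inj₂ u)) (y (u , Sign.+)) (y (u , Sign.-)) (z (inj₁ t)))
          (*-congʳ (*-congˡ {z (inj₂ u)} (py≃x u)))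
        -- Each row of the block is summed by `row`; the outer `distrib` then adds the two rows.
        entry (inj₂ u) (inj₂ v) = ≃-trans
          (+-cong (row Sign.+) (row Sign.-))
          (distrib (z (inj₂ u)) (p (Y (u , Sign.+)) v) (p (Y (u , Sign.-)) v) (z (inj₂ v)))
          where
          row : ∀ s → p (λ b → z (inj₂ u) * Y (u , s) b * z (inj₂ (proj₁ b))) v
                    ≃ z (inj₂ u) * p (Y (u , s)) v * z (inj₂ v)
          row s = distrib (z (inj₂ u)) (Y (u , s) (v , Sign.+)) (Y (u , s) (v , Sign.-)) (z (inj₂ v))

    -- Zero padding works because only the block on the + layer can be nonzero, and there conflicts
    -- are edges of `G` by `conflict-layer`.
    TH⊆BTH : TH G ⊆ BTH (G ±)
    TH⊆BTH {x} (X , X-sym , (_ , X-psd) , X-diag , X-edge) =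
      layer⁺ x , (Y , Y-sym , (bordered-sym , psd) , diag , λ {a} {b} → edge-zero {a} {b}) , p-layer⁺ x
      where
      Y : Matrix (V × Sign)
      Y = layer⁺² X

      Y-sym : SymmetricMatrix Y
      Y-sym (u , Sign.+) (v , Sign.+) = X-sym u v
      Y-sym (u , Sign.+) (v , Sign.-) = ≃⇒≈ {0ℝ} ≃-refl
      Y-sym (u , Sign.-) (v , Sign.+) = ≃⇒≈ {0ℝ} ≃-refl
      Y-sym (u , Sign.-) (v , Sign.-) = ≃⇒≈ {0ℝ} ≃-refl

      bordered-sym : SymmetricMatrix (bordered (layer⁺ x) Y)
      bordered-sym (inj₁ _) (inj₁ _) = ≃⇒≈ {1ℝ} ≃-refl
      bordered-sym (inj₁ _) (inj₂ b) = ≃⇒≈ {layer⁺ x b} ≃-refl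
      bordered-sym (inj₂ a) (inj₁ _) = ≃⇒≈ {layer⁺ x a} ≃-refl
      bordered-sym (inj₂ a) (inj₂ b) = Y-sym a b

      diag : ∀ a → Y a a ≈ layer⁺ x a
      diag (v , Sign.+) = X-diag v
      diag (v , Sign.-) = ≃⇒≈ {0ℝ} ≃-refl

      edge-zero : ∀ {a b} → C.Adj a b → Y a b ≈ 0ℝ
      edge-zero {u , Sign.+} {v , Sign.+} adj = X-edge (conflict-layer adj)
      edge-zero {u , Sign.+} {v , Sign.-} _   = ≃⇒≈ {0ℝ} ≃-refl
      edge-zero {u , Sign.-} {v , _}      _   = ≃⇒≈ {0ℝ} ≃-refl

      psd : ∀ z → 0ℝ ≤ ∑ λ a → ∑ λ b → z a * bordered (layer⁺ x) Y a b * z b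
      psd z = ≤-respʳ 0ℝ
        (≃-sym (≃-trans (∑∑-collapse λ a b → z a * bordered (layer⁺ x) Y a b * z b)
                        (∑-cong λ u → ∑-cong λ v → entry u v)))
        -- Terms with an index in the - layer vanish, so only the restriction of `z` to the border
        -- and the + layer matters.
        (X-psd (z ∘ ι))
        where
        ι : ⊤ ⊎ V → ⊤ ⊎ V × Sign
        ι = map₂ (_, Sign.+)

        drop : ∀ w a b → w + a * 0ℝ * b ≃ w
        drop w a b = termwise λ n →
          solve 3 (λ w a b → w :+ a :* con 0ℚ :* b := w) refl (seq w n) (seq a n) (seq b n)

        entry : ∀ u v → collapse² (λ a b → z a * bordered (layer⁺ x) Y a b * z b) u v
                      ≃ z (ι u) * bordered x X u v * z (ι v)
        entry (inj₁ _) (inj₁ _) = ≃-refl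
        entry (inj₁ t) (inj₂ v) = drop _ (z (inj₁ t)) (z (inj₂ (v , Sign.-)))
        entry (inj₂ u) (inj₁ t) = drop _ (z (inj₂ (u , Sign.-))) (z (inj₁ t))
        entry (inj₂ u) (inj₂ v) = begin
          -- First the `w⁻` term of each row is dropped, then the surviving `w⁺` term of the `z⁻`
          -- row.
          _  ≈⟨ +-cong (drop _ z⁺ w⁻) (drop _ z⁻ w⁻) ⟩
          _  ≈⟨ drop _ z⁻ w⁺ ⟩
          _  ∎
          where
          z⁺ = z (inj₂ (u , Sign.+))
          z⁻ = z (inj₂ (u , Sign.-))
          w⁺ = z (inj₂ (v , Sign.+))
          w⁻ = z (inj₂ (v , Sign.-))

theorem7p5 : (V : Set) {{_ : Finite V}} (G : SimpleGraph V) →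
    (BSTAB (G ±) ≐ STAB G) × (BTH (G ±) ≐ TH G) × (BQSTAB (G ±) ≐ QSTAB G)
theorem7p5 V G = BSTAB-± G , ((λ {x} → BTH⊆TH G {x}) , (λ {x} → TH⊆BTH G {x}))
  , ((λ {x} → BQSTAB⊆QSTAB G {x}) , (λ {x} → QSTAB⊆BQSTAB G {x}))
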